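{- Let $S$ be a numerical semigroup with multiplicity $m$, embedding dimension $\nu$ and conductor $f+1=qm-\rho$ for some $q\in\mathbb N$ and $0\le\rho\le m-1$. If $\left(2+\frac1q\right)\nu\ge m$, then $S$ satisfies Wilf's Conjecture, i.e. $f+1\le\nu n$.
   Context: A numerical semigroup is a submonoid of $(\mathbb N,+)$ with finite complement. $f$ is its Frobenius number (largest integer not in $S$), $m$ its smallest nonzero element, $\nu$ its minimal number of generators, and $n=|\{s\in S: s<f\}|$. -}

module Defs where

open import Data.Nat using (ℕ; zero; suc; _+_; _*_; _≤_; _<_)
open import Data.Bool using (Bool; true; false; if_then_else_)
open import Data.List using (List; []; _∷_; length)
open import Data.Product using (Σ; _×_; ∃)
open import Relation.Binary.PropositionalEquality using (_≡_)
open import Relation.Nullary using (¬_)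
open import Function.Bundles using (_⇔_)

record NumericalSemigroup : Set where
  field
    mem      : ℕ → Bool
    mem-zero : mem 0 ≡ true
    mem-add  : ∀ a b → mem a ≡ true → mem b ≡ true → mem (a + b) ≡ true
    cofinite : Σ ℕ λ N → ∀ k → N ≤ k → mem k ≡ true

open NumericalSemigroup public

_∈S_ : ℕ → NumericalSemigroup → Set
x ∈S S = mem S x ≡ true

IsConductor : NumericalSemigroup → ℕ → Set
IsConductor S zero    = ∀ k → k ∈S S
IsConductor S (suc f) = (∀ k → suc f ≤ k → k ∈S S) × ¬ (f ∈S S)

IsMultiplicity : NumericalSemigroup → ℕ → Set
IsMultiplicity S m = (0 < m) × (m ∈S S) × (∀ k → 0 < k → k < m → ¬ (k ∈S S))

data Combination : List ℕ → ℕ → Set where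
  comb-nil  : Combination [] 0
  comb-skip : ∀ {g gs x} → Combination gs x → Combination (g ∷ gs) x
  comb-use  : ∀ {g gs x} → Combination (g ∷ gs) x → Combination (g ∷ gs) (g + x)

Generates : List ℕ → NumericalSemigroup → Set
Generates gs S = ∀ x → (x ∈S S) ⇔ Combination gs x

IsEmbeddingDimension : NumericalSemigroup → ℕ → Set
IsEmbeddingDimension S ν =
  (Σ (List ℕ) λ gs → Generates gs S × length gs ≡ ν) ×
  (∀ gs → Generates gs S → ν ≤ length gs)

countBelow : NumericalSemigroup → ℕ → ℕ
countBelow S zero    = 0
countBelow S (suc k) = countBelow S k + (if mem S k then 1 else 0)

-- n = |{ s ∈ S : s < f }|, where c = f + 1 is the conductor
-- (since f ∉ S this is the number of elements of S below c).
sporadicCount : NumericalSemigroup → ℕ → ℕ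
sporadicCount S c = countBelow S c

{-# OPTIONS --safe #-}

-- Let Ap be the Apéry set of m and, for w in Ap, let d(w) be the number of elements of w + mℕ
-- below the conductor c = qm − ρ; then d(0) = q and n = q + D with D the sum of d over Ap \ {0}.
-- If D > q, then n ≥ 2q + 1 and the hypothesis gives νn ≥ qm ≥ c.
-- Let P be the number of decomposable elements of Ap (those that are a sum of two nonzero elements
-- of Ap), so that m = ν + P; Wilf's inequality reads qP ≤ νD + ρ.
-- If x + y is in Ap, then d(x) + d(y) ≥ q, except that it can be q − 1 for the at most ρ elements
-- of Ap in [m + c − ρ , m + c).
-- If no decomposable element lies below c, then each z in Ap occurs at most ν times in all
-- decompositions, and summing d(x) + d(y) over the decomposable elements gives the inequality.
-- If some decomposable element lies below c and D ≤ q, the lower bounds on d(x) + d(y) nearly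
-- exhaust D: that element is unique and equal to some 2x, every decomposable element is x plus an
-- element of Ap, there are at most three of them, and they are treated by hand.

module Submission where

open import Defs
open import Data.Bool using (true; false; if_then_else_)
import Data.Bool.Properties as Bool
open import Data.Empty using (⊥-elim)
open import Data.List using ([]; _∷_; length; map)
open import Data.List.Membership.Propositional using (_∈_)
import Data.List.Relation.Unary.All as All
open import Data.List.Relation.Unary.All using (All) renaming ([] to []ᴬ; _∷_ to _∷ᴬ_)
open import Data.List.Relation.Unary.Any using (here; there)
open import Data.List.Relation.Unary.Unique.Propositional using (Unique) renaming ([] to []ᵁ; _∷_ to _∷ᵁ_)
open import Data.Nat using (ℕ; zero; suc; _+_; _*_; _∸_; _≤_; _<_; _/_; z≤n; s≤s; NonZero; >-nonZero)
open import Data.Nat.Divisibility using (∣-refl)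
open import Data.Nat.DivMod using (m/n*n≤m; m<n⇒m/n≡0; m<n*o⇒m/o<n; +-distrib-/-∣ˡ; n/n≡1; /-monoˡ-≤; m*n/n≡m)
open import Data.Nat.ListAction using (sum)
open import Data.Nat.Properties
open import Data.Nat.Tactic.RingSolver using (solve)
open import Data.Product using (∃; _×_; _,_; proj₁; proj₂)
open import Data.Sum using (_⊎_; inj₁; inj₂)
open import Data.List.Membership.DecPropositional _≟_ using (_∈?_)
open import Function using (_∘_; case_of_)
open import Function.Bundles using (Equivalence)
open import Relation.Binary.PropositionalEquality
open import Relation.Nullary using (¬_; Dec; yes; no; contradiction)
open import Relation.Nullary.Decidable using (_×-dec_; ¬?)

-- Here a ≤ b is meant to be a sum of hypotheses and k the slack;
-- a contradiction is derived as 1 ≤ 0.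
linear : ∀ {a b p q} k → a ≤ b → p + b + k ≡ q + a → p ≤ q
linear {a} {b} {p} {q} k a≤b eq = +-cancelʳ-≤ b p q (begin
  p + b      ≤⟨ m≤m+n (p + b) k ⟩
  p + b + k  ≡⟨ eq ⟩
  q + a      ≤⟨ +-monoʳ-≤ q a≤b ⟩
  q + b      ∎)
  where open ≤-Reasoning

-- Indicators and finite sums.

𝟙 : ∀ {P : Set} → Dec P → ℕ
𝟙 (yes _) = 1
𝟙 (no _)  = 0

𝟙-true : ∀ {P : Set} (P? : Dec P) → P → 𝟙 P? ≡ 1
𝟙-true (yes _) _ = refl
𝟙-true (no ¬p) p = contradiction p ¬p

𝟙-false : ∀ {P : Set} (P? : Dec P) → ¬ P → 𝟙 P? ≡ 0
𝟙-false (yes p) ¬p = contradiction p ¬p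
𝟙-false (no _)  _  = refl

𝟙≤1 : ∀ {P : Set} (P? : Dec P) → 𝟙 P? ≤ 1
𝟙≤1 (yes _) = ≤-refl
𝟙≤1 (no _)  = z≤n

𝟙-mono : ∀ {P Q : Set} (P? : Dec P) (Q? : Dec Q) → (P → Q) → 𝟙 P? ≤ 𝟙 Q?
𝟙-mono (yes p) Q? f = ≤-reflexive (sym (𝟙-true Q? (f p)))
𝟙-mono (no _)  Q? f = z≤n

𝟙-⊎ : ∀ {P Q R : Set} (P? : Dec P) (Q? : Dec Q) (R? : Dec R) → (P → Q ⊎ R) → 𝟙 P? ≤ 𝟙 Q? + 𝟙 R?
𝟙-⊎ (no _)  Q? R? f = z≤n
𝟙-⊎ (yes p) Q? R? f with f p
... | inj₁ q rewrite 𝟙-true Q? q = s≤s z≤n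
... | inj₂ r rewrite 𝟙-true R? r = m≤n+m 1 (𝟙 Q?)

sumBelow : ℕ → (ℕ → ℕ) → ℕ
sumBelow zero    f = 0
sumBelow (suc n) f = sumBelow n f + f n

sumBelow-mono : ∀ n {f g : ℕ → ℕ} → (∀ i → i < n → f i ≤ g i) → sumBelow n f ≤ sumBelow n g
sumBelow-mono zero    f≤g = z≤n
sumBelow-mono (suc n) f≤g = +-mono-≤ (sumBelow-mono n (λ i i<n → f≤g i (m≤n⇒m≤1+n i<n))) (f≤g n ≤-refl)

sumBelow-cong : ∀ n {f g : ℕ → ℕ} → (∀ i → i < n → f i ≡ g i) → sumBelow n f ≡ sumBelow n g
sumBelow-cong zero    f≡g = refl
sumBelow-cong (suc n) f≡g = cong₂ _+_ (sumBelow-cong n (λ i i<n → f≡g i (m≤n⇒m≤1+n i<n))) (f≡g n ≤-refl)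

sumBelow-const : ∀ n k → sumBelow n (λ _ → k) ≡ n * k
sumBelow-const zero    k = refl
sumBelow-const (suc n) k = trans (cong (_+ k) (sumBelow-const n k)) (+-comm (n * k) k)

sumBelow-zero : ∀ n {f : ℕ → ℕ} → (∀ i → i < n → f i ≡ 0) → sumBelow n f ≡ 0
sumBelow-zero n f≡0 = trans (sumBelow-cong n f≡0) (trans (sumBelow-const n 0) (*-zeroʳ n))

sumBelow-+ : ∀ n f g → sumBelow n (λ i → f i + g i) ≡ sumBelow n f + sumBelow n g
sumBelow-+ zero    f g = refl
sumBelow-+ (suc n) f g = trans (cong (_+ (f n + g n)) (sumBelow-+ n f g))
  (interchange (sumBelow n f) (sumBelow n g) (f n) (g n))
  where
  interchange : ∀ a b c d → a + b + (c + d) ≡ a + c + (b + d)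
  interchange a b c d = solve (a ∷ b ∷ c ∷ d ∷ [])

sumBelow-*ˡ : ∀ n k f → sumBelow n (λ i → k * f i) ≡ k * sumBelow n f
sumBelow-*ˡ zero    k f = sym (*-zeroʳ k)
sumBelow-*ˡ (suc n) k f = trans (cong (_+ k * f n) (sumBelow-*ˡ n k f)) (sym (*-distribˡ-+ k (sumBelow n f) (f n)))

sumBelow-*ʳ : ∀ n k f → sumBelow n (λ i → f i * k) ≡ sumBelow n f * k
sumBelow-*ʳ zero    k f = refl
sumBelow-*ʳ (suc n) k f = trans (cong (_+ f n * k) (sumBelow-*ʳ n k f)) (sym (*-distribʳ-+ k (sumBelow n f) (f n)))

sumBelow-swap : ∀ m n (f : ℕ → ℕ → ℕ) →
  sumBelow m (λ i → sumBelow n (f i)) ≡ sumBelow n (λ j → sumBelow m (λ i → f i j))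
sumBelow-swap zero    n f = sym (sumBelow-zero n (λ _ _ → refl))
sumBelow-swap (suc m) n f = trans (cong (_+ sumBelow n (f m)) (sumBelow-swap m n f))
  (sym (sumBelow-+ n (λ j → sumBelow m (λ i → f i j)) (f m)))

sumBelow-append : ∀ m n f → sumBelow (m + n) f ≡ sumBelow m f + sumBelow n (λ i → f (m + i))
sumBelow-append m zero    f = trans (cong (λ k → sumBelow k f) (+-identityʳ m)) (sym (+-identityʳ _))
sumBelow-append m (suc n) f rewrite +-suc m n =
  trans (cong (_+ f (m + n)) (sumBelow-append m n f)) (+-assoc (sumBelow m f) _ _)

sumBelow-point : ∀ n x v → x < n → sumBelow n (λ w → 𝟙 (w ≟ x) * v) ≡ v
sumBelow-point (suc n) x v x<1+n with n ≟ x
... | yes refl = 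
  cong₂ _+_ (sumBelow-zero n (λ i i<n → cong (_* v) (𝟙-false (i ≟ x) (<⇒≢ i<n)))) (+-identityʳ v)
... | no n≢x = trans (+-identityʳ _) (sumBelow-point n x v (≤∧≢⇒< (≤-pred x<1+n) (n≢x ∘ sym)))

sumBelow-point-≤ : ∀ n x → sumBelow n (λ w → 𝟙 (w ≟ x)) ≤ 1
sumBelow-point-≤ zero    x = z≤n
sumBelow-point-≤ (suc n) x with n ≟ x
... | yes refl = ≤-reflexive (cong (_+ 1) (sumBelow-zero n (λ i i<n → 𝟙-false (i ≟ x) (<⇒≢ i<n))))
... | no _ = ≤-trans (≤-reflexive (+-identityʳ _)) (sumBelow-point-≤ n x)

sumBelow-∈ : ∀ n xs → sumBelow n (λ w → 𝟙 (w ∈? xs)) ≤ length xs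
sumBelow-∈ n []       = ≤-reflexive (sumBelow-zero n (λ _ _ → refl))
sumBelow-∈ n (x ∷ xs) = begin
  sumBelow n (λ w → 𝟙 (w ∈? x ∷ xs))                                 ≤⟨ sumBelow-mono n (λ w _ → step w) ⟩
  sumBelow n (λ w → 𝟙 (w ≟ x) + 𝟙 (w ∈? xs))                        ≡⟨ sumBelow-+ n _ _ ⟩
  sumBelow n (λ w → 𝟙 (w ≟ x)) + sumBelow n (λ w → 𝟙 (w ∈? xs))     ≤⟨ +-mono-≤ (sumBelow-point-≤ n x) (sumBelow-∈ n xs) ⟩
  suc (length xs)                                                    ∎
  where
  open ≤-Reasoning
  step : ∀ w → 𝟙 (w ∈? x ∷ xs) ≤ 𝟙 (w ≟ x) + 𝟙 (w ∈? xs)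
  step w = 𝟙-⊎ (w ∈? x ∷ xs) (w ≟ x) (w ∈? xs) λ where
    (here w≡x) → inj₁ w≡x
    (there w∈) → inj₂ w∈

without : ℕ → (ℕ → ℕ) → ℕ → ℕ
without x f w = 𝟙 (¬? (w ≟ x)) * f w

sumBelow-without : ∀ n x f → x < n → sumBelow n f ≡ f x + sumBelow n (without x f)
sumBelow-without n x f x<n = begin
  sumBelow n f                                                       ≡⟨ sumBelow-cong n (λ w _ → split w) ⟩
  sumBelow n (λ w → 𝟙 (w ≟ x) * f x + without x f w)                ≡⟨ sumBelow-+ n _ _ ⟩
  sumBelow n (λ w → 𝟙 (w ≟ x) * f x) + sumBelow n (without x f)     ≡⟨ cong (_+ sumBelow n (without x f)) (sumBelow-point n x (f x) x<n) ⟩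
  f x + sumBelow n (without x f)                                     ∎
  where
  open ≡-Reasoning
  split : ∀ w → f w ≡ 𝟙 (w ≟ x) * f x + without x f w
  split w with w ≟ x
  ... | yes refl = sym (trans (+-identityʳ _) (+-identityʳ _))
  ... | no _     = sym (+-identityʳ _)

-- Distinctness lets each entry be removed in turn: zeroing `f` at the head leaves its values on the
-- tail unchanged.
sum-≤-sumBelow : ∀ n f xs → Unique xs → All (_< n) xs → sum (map f xs) ≤ sumBelow n f
sum-≤-sumBelow n f []       _            _            = z≤n
sum-≤-sumBelow n f (x ∷ xs) (x≢ ∷ᵁ uniq) (x<n ∷ᴬ xs<n) = begin
  f x + sum (map f xs)                ≡⟨ cong (f x +_) (outside xs x≢) ⟩
  f x + sum (map (without x f) xs)    ≤⟨ +-monoʳ-≤ (f x) (sum-≤-sumBelow n (without x f) xs uniq xs<n) ⟩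
  f x + sumBelow n (without x f)      ≡⟨ sumBelow-without n x f x<n ⟨
  sumBelow n f                        ∎
  where
  open ≤-Reasoning
  outside : ∀ ys → All (x ≢_) ys → sum (map f ys) ≡ sum (map (without x f) ys)
  outside []       _          = refl
  outside (y ∷ ys) (x≢y ∷ᴬ p) = cong₂ _+_
    (sym (trans (cong (_* f y) (𝟙-true (¬? (y ≟ x)) (x≢y ∘ sym))) (+-identityʳ (f y))))
    (outside ys p)

-- The translate of `f` by `z`; the indicator makes it zero below `z`, where `w ∸ z` is truncated.
shift : ℕ → (ℕ → ℕ) → ℕ → ℕ
shift z f w = 𝟙 (z ≤? w) * f (w ∸ z)

shift-+ : ∀ z f i → shift z f (z + i) ≡ f i
shift-+ z f i rewrite 𝟙-true (z ≤? z + i) (m≤m+n z i) | m+n∸m≡n z i = +-identityʳ (f i)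

sumBelow-shift : ∀ z n f → sumBelow (z + n) (shift z f) ≡ sumBelow n f
sumBelow-shift z n f = trans (sumBelow-append z n (shift z f)) (cong₂ _+_
  (sumBelow-zero z (λ i i<z → cong (_* f (i ∸ z)) (𝟙-false (z ≤? i) (<⇒≱ i<z))))
  (sumBelow-cong n (λ i _ → shift-+ z f i)))

sumBelow-shift-≤ : ∀ z n f → sumBelow n (shift z f) ≤ sumBelow n f
sumBelow-shift-≤ z n f = begin
  sumBelow n (shift z f)        ≤⟨ m≤m+n _ _ ⟩
  sumBelow n (shift z f) + _    ≡⟨ sumBelow-append n z (shift z f) ⟨
  sumBelow (n + z) (shift z f)  ≡⟨ cong (λ k → sumBelow k (shift z f)) (+-comm n z) ⟩
  sumBelow (z + n) (shift z f)  ≡⟨ sumBelow-shift z n f ⟩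
  sumBelow n f                  ∎
  where open ≤-Reasoning

-- The induction on `k` keeps `n` fixed. With `n = k = m + c` and `r = ρ` this bounds the number of
-- exceptional sums by `ρ`.
sumBelow-last : ∀ n k r → sumBelow k (λ w → 𝟙 (n ≤? w + r)) ≤ (k + r) ∸ n
sumBelow-last n zero    r = z≤n
sumBelow-last n (suc k) r with n ≤? k + r
... | yes n≤ = begin
  sumBelow k (λ w → 𝟙 (n ≤? w + r)) + 1  ≤⟨ +-monoˡ-≤ 1 (sumBelow-last n k r) ⟩
  k + r ∸ n + 1                           ≡⟨ +-comm (k + r ∸ n) 1 ⟩
  suc (k + r ∸ n)                         ≡⟨ +-∸-assoc 1 n≤ ⟨
  suc (k + r) ∸ n                         ∎
  where open ≤-Reasoning
... | no _ = begin
  sumBelow k (λ w → 𝟙 (n ≤? w + r)) + 0  ≡⟨ +-identityʳ _ ⟩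
  sumBelow k (λ w → 𝟙 (n ≤? w + r))      ≤⟨ sumBelow-last n k r ⟩
  k + r ∸ n                               ≤⟨ ∸-monoˡ-≤ n (n≤1+n (k + r)) ⟩
  suc (k + r) ∸ n                         ∎
  where open ≤-Reasoning

𝟙-×¬ : ∀ {P Q R : Set} (P? : Dec P) (Q? : Dec Q) (R? : Dec R) → (Q → R → P) →
       𝟙 P? ≡ 𝟙 (P? ×-dec ¬? (Q? ×-dec R?)) + 𝟙 Q? * 𝟙 R?
𝟙-×¬ (yes p) (yes q) (yes r) f = refl
𝟙-×¬ (yes p) (yes q) (no ¬r) f = refl
𝟙-×¬ (yes p) (no ¬q) R?      f = refl
𝟙-×¬ (no ¬p) (yes q) (yes r) f = contradiction (f q r) ¬p
𝟙-×¬ (no ¬p) (yes q) (no ¬r) f = refl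
𝟙-×¬ (no ¬p) (no ¬q) R?      f = refl

𝟙-× : ∀ {P Q : Set} (P? : Dec P) (Q? : Dec Q) → 𝟙 P? ≡ 𝟙 (P? ×-dec ¬? Q?) + 𝟙 (P? ×-dec Q?)
𝟙-× (yes p) (yes q) = refl
𝟙-× (yes p) (no ¬q) = refl
𝟙-× (no ¬p) Q?      = refl

*𝟙-≤ : ∀ {P : Set} {n} k (P? : Dec P) → (P → k ≤ n) → k * 𝟙 P? ≤ n
*𝟙-≤ k (yes p) k≤n = ≤-trans (≤-reflexive (*-identityʳ k)) (k≤n p)
*𝟙-≤ k (no ¬p) k≤n = ≤-trans (≤-reflexive (*-zeroʳ k)) z≤n

count-≤ : ∀ n {Q : ℕ → Set} (Q? : ∀ w → Dec (Q w)) xs → (∀ {w} → Q w → w ∈ xs) →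
          sumBelow n (λ w → 𝟙 (Q? w)) ≤ length xs
count-≤ n Q? xs Q⊆xs = ≤-trans (sumBelow-mono n (λ w _ → 𝟙-mono (Q? w) (w ∈? xs) Q⊆xs)) (sumBelow-∈ n xs)

count-≥ : ∀ n {Q : ℕ → Set} (Q? : ∀ w → Dec (Q w)) xs → Unique xs → All (_< n) xs → All Q xs →
          length xs ≤ sumBelow n (λ w → 𝟙 (Q? w))
count-≥ n {Q} Q? xs uniq xs<n xs⊆Q =
  ≤-trans (≤-reflexive (ones xs⊆Q)) (sum-≤-sumBelow n (λ w → 𝟙 (Q? w)) xs uniq xs<n)
  where
  ones : ∀ {ys} → All Q ys → length ys ≡ sum (map (λ w → 𝟙 (Q? w)) ys)
  ones []ᴬ              = refl
  ones (_∷ᴬ_ {y} qy qys) = cong₂ _+_ (sym (𝟙-true (Q? y) qy)) (ones qys)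

-- Combinations of generators and irreducible elements.

combination-zero : ∀ gs → Combination gs 0
combination-zero []       = comb-nil
combination-zero (g ∷ gs) = comb-skip (combination-zero gs)

combination-∈ : ∀ {g gs} → g ∈ gs → Combination gs g
combination-∈ {g} {.g ∷ gs} (here refl) =
  subst (Combination (g ∷ gs)) (+-identityʳ g) (comb-use (combination-zero (g ∷ gs)))
combination-∈ (there g∈) = comb-skip (combination-∈ g∈)

module _ (S : NumericalSemigroup) where

  Irreducible : ℕ → Set
  Irreducible w = ∀ x y → 0 < x → 0 < y → x ∈S S → y ∈S S → x + y ≢ w

  combination-∈S : ∀ {gs x} → (∀ {g} → g ∈ gs → g ∈S S) → Combination gs x → x ∈S S
  combination-∈S gs⊆S comb-nil       = mem-zero S
  combination-∈S gs⊆S (comb-skip c)  = combination-∈S (gs⊆S ∘ there) c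
  combination-∈S gs⊆S (comb-use c)   = mem-add S _ _ (gs⊆S (here refl)) (combination-∈S gs⊆S c)

  -- A positive generator used with a nonzero remainder would split `w` inside `S`; hence the
  -- remainder is 0 and the generator is `w` itself.
  irreducible-∈ : ∀ {gs w} → (∀ {g} → g ∈ gs → g ∈S S) → 0 < w → Irreducible w → Combination gs w → w ∈ gs
  irreducible-∈ gs⊆S 0<w irr (comb-skip c) = there (irreducible-∈ (gs⊆S ∘ there) 0<w irr c)
  -- A generator 0 contributes nothing, so the recursion continues with the same `w`.
  irreducible-∈ gs⊆S 0<w irr (comb-use {zero} c) = irreducible-∈ gs⊆S 0<w irr c
  irreducible-∈ gs⊆S 0<w irr (comb-use {suc g} {x = zero} c) = here (+-identityʳ (suc g))
  irreducible-∈ gs⊆S 0<w irr (comb-use {suc g} {x = suc x} c) =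
    contradiction refl (irr (suc g) (suc x) (s≤s z≤n) (s≤s z≤n) (gs⊆S (here refl)) (combination-∈S gs⊆S c))

  multiple-∈S : ∀ k {x} → x ∈S S → (k * x) ∈S S
  multiple-∈S zero    _   = mem-zero S
  multiple-∈S (suc k) x∈S = mem-add S _ _ x∈S (multiple-∈S k x∈S)

  countBelow≡sumBelow : ∀ n → countBelow S n ≡ sumBelow n (λ i → 𝟙 (mem S i Bool.≟ true))
  countBelow≡sumBelow zero    = refl
  countBelow≡sumBelow (suc n) = cong₂ _+_ (countBelow≡sumBelow n) (lemma (mem S n))
    where
    lemma : ∀ b → (if b then 1 else 0) ≡ 𝟙 (b Bool.≟ true)
    lemma true  = refl
    lemma false = refl

  -- The Apéry set of `m`.

  module _ {m c q ρ : ℕ} (isMult : IsMultiplicity S m) (above : ∀ k → c ≤ k → k ∈S S)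
           (c+ρ≡qm : c + ρ ≡ q * m) (ρ<m : ρ < m) where

    0<m : 0 < m
    0<m = proj₁ isMult

    m∈S : m ∈S S
    m∈S = proj₁ (proj₂ isMult)

    instance
      m≢0 : NonZero m
      m≢0 = >-nonZero 0<m

    _∈S? : ∀ x → Dec (x ∈S S)
    x ∈S? = mem S x Bool.≟ true

    -- The guard `m ≤ x` is there because subtraction truncates: it keeps 0 in the set.
    Apery : ℕ → Set
    Apery x = x ∈S S × ¬ (m ≤ x × (x ∸ m) ∈S S)

    Apery? : ∀ x → Dec (Apery x)
    Apery? x = x ∈S? ×-dec ¬? (m ≤? x ×-dec (x ∸ m) ∈S?)

    Apery⁺ : ℕ → Set
    Apery⁺ x = 0 < x × Apery x

    Apery⁺? : ∀ x → Dec (Apery⁺ x)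
    Apery⁺? x = 0 <? x ×-dec Apery? x

    -- The bound `x < w` makes the search finite and the property decidable.
    Decomposable : ℕ → Set
    Decomposable w = ∃ λ x → x < w × (Apery⁺ x × Apery⁺ (w ∸ x))

    Decomposable? : ∀ w → Dec (Decomposable w)
    Decomposable? w = anyUpTo? (λ x → Apery⁺? x ×-dec Apery⁺? (w ∸ x)) w

    Composite : ℕ → Set
    Composite w = Apery w × Decomposable w

    Composite? : ∀ w → Dec (Composite w)
    Composite? w = Apery? w ×-dec Decomposable? w

    -- The minimal generators other than m.
    Generator : ℕ → Set
    Generator w = Apery⁺ w × ¬ Decomposable w

    Generator? : ∀ w → Dec (Generator w)
    Generator? w = Apery⁺? w ×-dec ¬? (Decomposable? w)

    -- Otherwise `w ∸ m` would be at least `c`, hence in `S`. Sums below `m + c` therefore see the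
    -- whole Apéry set.
    apery-< : ∀ {w} → Apery w → w < m + c
    apery-< {w} (w∈S , ¬p) = ≰⇒> λ m+c≤w →
      ¬p (≤-trans (m≤m+n m c) m+c≤w , above (w ∸ m) (m+n≤o⇒m≤o∸n c (subst (_≤ w) (+-comm m c) m+c≤w)))

    apery⁺->m : ∀ {w} → Apery⁺ w → m < w
    apery⁺->m {w} (0<w , w∈S , ¬p) = ≤∧≢⇒<
      (≮⇒≥ λ w<m → proj₂ (proj₂ isMult) w 0<w w<m w∈S)
      λ m≡w → ¬p (≤-reflexive m≡w , subst (_∈S S) (sym (trans (cong (w ∸_) m≡w) (n∸n≡0 w))) (mem-zero S))

    -- If `x ∸ m` were in `S`, adding `y` would put `x + y ∸ m` in `S`.
    apery-+ˡ : ∀ {x y} → x ∈S S → y ∈S S → Apery (x + y) → Apery x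
    apery-+ˡ {x} {y} x∈S y∈S (_ , ¬p) = x∈S , λ (m≤x , x∸m∈S) →
      ¬p (≤-trans m≤x (m≤m+n x y) , subst (_∈S S) (sym (+-∸-comm y m≤x)) (mem-add S (x ∸ m) y x∸m∈S y∈S))

    apery-+ʳ : ∀ {x y} → x ∈S S → y ∈S S → Apery (x + y) → Apery y
    apery-+ʳ {x} {y} x∈S y∈S a = apery-+ˡ y∈S x∈S (subst Apery (+-comm x y) a)

    decompose : ∀ {w} → Decomposable w → ∃ λ x → ∃ λ y → x + y ≡ w × Apery⁺ x × Apery⁺ y
    decompose {w} (x , x<w , ax , ay) = x , w ∸ x , m+[n∸m]≡n (<⇒≤ x<w) , ax , ay

    decomposable-+ : ∀ {x y} → Apery⁺ x → Apery⁺ y → Decomposable (x + y)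
    decomposable-+ {x} {y} ax ay = x , m<m+n x (proj₁ ay) , ax , subst Apery⁺ (sym (m+n∸m≡n x y)) ay

    summand-< : ∀ {x y} → Apery⁺ y → Apery (x + y) → x < c
    summand-< {x} {y} ay a = +-cancelˡ-< m x c (begin-strict
      m + x  <⟨ +-monoˡ-< x (apery⁺->m ay) ⟩
      y + x  ≡⟨ +-comm y x ⟩
      x + y  <⟨ apery-< a ⟩
      m + c  ∎)
      where open ≤-Reasoning

    -- Depths and the conductor.

    -- The number of elements of w + mℕ below c.
    depth : ℕ → ℕ
    depth w = q ∸ (w + ρ) / m

    depth-zero : depth 0 ≡ q
    depth-zero = cong (q ∸_) (m<n⇒m/n≡0 ρ<m)

    -- Adding `ρ` moves the conductor to `q * m`, the end of a block of length `m`; `depth w` counts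
    -- the blocks from that of `w + ρ` on.
    depth-covers : ∀ w → c ≤ depth w * m + w
    depth-covers w = +-cancelʳ-≤ ρ c _ (begin
      c + ρ                              ≡⟨ c+ρ≡qm ⟩
      q * m                              ≤⟨ *-monoˡ-≤ m (m≤n+m∸n q l) ⟩
      (l + depth w) * m                  ≡⟨ *-distribʳ-+ m l (depth w) ⟩
      l * m + depth w * m                ≤⟨ +-monoˡ-≤ (depth w * m) (m/n*n≤m (w + ρ) m) ⟩
      w + ρ + depth w * m                ≡⟨ +-comm (w + ρ) (depth w * m) ⟩
      depth w * m + (w + ρ)              ≡⟨ +-assoc (depth w * m) w ρ ⟨
      depth w * m + w + ρ                ∎)
      where
      open ≤-Reasoning
      l = (w + ρ) / m

    depth-≥ : ∀ {w} → c ≤ w → depth w ≡ 0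
    depth-≥ {w} c≤w = m≤n⇒m∸n≡0 (begin
      q            ≡⟨ m*n/n≡m q m ⟨
      q * m / m    ≡⟨ cong (_/ m) c+ρ≡qm ⟨
      (c + ρ) / m  ≤⟨ /-monoˡ-≤ m (+-monoˡ-≤ ρ c≤w) ⟩
      (w + ρ) / m  ∎)
      where open ≤-Reasoning

    -- The quotient grows by one, and `l<q` keeps the truncated subtraction exact.
    depth-step : ∀ {w} → w < c → depth w ≡ suc (depth (m + w))
    depth-step {w} w<c = begin
      q ∸ l                         ≡⟨ +-∸-assoc 1 l<q ⟩
      suc (q ∸ suc l)               ≡⟨ cong (λ k → suc (q ∸ k)) quot ⟨
      suc (depth (m + w))           ∎
      where
      open ≡-Reasoning
      l = (w + ρ) / m
      l<q : l < q
      l<q = m<n*o⇒m/o<n (subst (w + ρ <_) c+ρ≡qm (+-monoˡ-< ρ w<c))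
      quot : (m + w + ρ) / m ≡ suc l
      quot = begin
        (m + w + ρ) / m         ≡⟨ cong (_/ m) (+-assoc m w ρ) ⟩
        (m + (w + ρ)) / m       ≡⟨ +-distrib-/-∣ˡ (w + ρ) (∣-refl {m}) ⟩
        m / m + (w + ρ) / m     ≡⟨ cong (_+ l) (n/n≡1 m) ⟩
        suc l                   ∎

    depth-pos : ∀ {w} → w < c → 1 ≤ depth w
    depth-pos w<c = subst (1 ≤_) (sym (depth-step w<c)) (s≤s z≤n)

    -- Below `m + c` these are the last `ρ` numbers; only there can the depths of two summands add
    -- up to `q − 1`.
    last? : ∀ w → Dec (m + c ≤ w + ρ)
    last? w = m + c ≤? w + ρ

    -- Adding `depth-covers` for `x` and `y` gives `2c ≤ (depth x + depth y) m + x + y`. Since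
    -- `qm = c + ρ`, a sum of depths at most `q − 1` forces `x + y ≥ m + c − ρ`, and one at most
    -- `q − 2` forces `x + y > m + c`.
    depth-+ : ∀ {x y} → Apery (x + y) → q ≤ depth x + depth y + 𝟙 (last? (x + y))
    depth-+ {x} {y} a with last? (x + y)
    ... | no ¬l = ≮⇒≥ λ short → n≮0 (arith (depth x) (depth y) short (depth-covers x) (depth-covers y) (≰⇒> ¬l))
      where
      arith : ∀ u v → u + v + 0 < q → c ≤ u * m + x → c ≤ v * m + y → x + y + ρ < m + c → 1 ≤ 0
      arith u v h₁ h₂ h₃ h₄ = linear {p = 1} {q = 0} 0
        (+-mono-≤ (+-mono-≤ (subst (suc (u + v + 0) * m ≤_) (sym c+ρ≡qm) (*-monoˡ-≤ m h₁)) h₂) (+-mono-≤ h₃ h₄))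
        (solve (u ∷ v ∷ x ∷ y ∷ m ∷ c ∷ ρ ∷ []))
    ... | yes _ = ≮⇒≥ λ short → n≮0 (arith (depth x) (depth y) short (depth-covers x) (depth-covers y) (apery-< a) ρ<m)
      where
      arith : ∀ u v → u + v + 1 < q → c ≤ u * m + x → c ≤ v * m + y → x + y < m + c → ρ < m → 1 ≤ 0
      arith u v h₁ h₂ h₃ h₄ h₅ = linear {p = 1} {q = 0} 1
        (+-mono-≤ (+-mono-≤ (+-mono-≤ (subst (suc (u + v + 1) * m ≤_) (sym c+ρ≡qm) (*-monoˡ-≤ m h₁)) h₂) (+-mono-≤ h₃ h₄)) h₅)
        (solve (u ∷ v ∷ x ∷ y ∷ m ∷ c ∷ ρ ∷ []))

    depth-+-small : ∀ {x y} → Apery (x + y) → x + y < c → q ≤ depth x + depth y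
    depth-+-small {x} {y} a w<c = subst (q ≤_)
      (trans (cong (depth x + depth y +_) (𝟙-false (last? (x + y)) (<⇒≱ not-last))) (+-identityʳ _))
      (depth-+ a)
      where
      not-last : x + y + ρ < m + c
      not-last = subst (x + y + ρ <_) (+-comm c m) (+-mono-<-≤ w<c (<⇒≤ ρ<m))

    -- Sums over the Apéry set

    total : (ℕ → ℕ) → ℕ
    total = sumBelow (m + c)

    #generators #composites depthSum : ℕ
    #generators = total (λ w → 𝟙 (Generator? w))
    #composites = total (λ w → 𝟙 (Composite? w))
    depthSum    = total (λ w → 𝟙 (Apery⁺? w) * depth w)

    -- `S` is the disjoint union of the Apéry set and `m + S`.
    membership-split : ∀ i → 𝟙 (i ∈S?) ≡ 𝟙 (Apery? i) + shift m (λ j → 𝟙 (j ∈S?)) i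
    membership-split i = 𝟙-×¬ (i ∈S?) (m ≤? i) ((i ∸ m) ∈S?)
      λ m≤i i∸m∈S → subst (_∈S S) (m+[n∸m]≡n m≤i) (mem-add S m (i ∸ m) m∈S i∸m∈S)

    nonzero-split : ∀ w → 𝟙 (Apery? w) ≡ 𝟙 (w ≟ 0) + 𝟙 (Apery⁺? w)
    nonzero-split zero    = trans (𝟙-true (Apery? 0) (mem-zero S , λ (m≤0 , _) → <⇒≱ 0<m m≤0))
                                  (sym (cong suc (𝟙-false (Apery⁺? 0) (n≮0 ∘ proj₁))))
    nonzero-split (suc w) = ≤-antisym
      (𝟙-mono (Apery? (suc w)) (Apery⁺? (suc w)) (s≤s z≤n ,_))
      (𝟙-mono (Apery⁺? (suc w)) (Apery? (suc w)) proj₂)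

    composite-split : ∀ w → 𝟙 (Apery⁺? w) ≡ 𝟙 (Generator? w) + 𝟙 (Composite? w)
    composite-split w = trans (𝟙-× (Apery⁺? w) (Decomposable? w)) (cong (𝟙 (Generator? w) +_) (≤-antisym
      (𝟙-mono (Apery⁺? w ×-dec Decomposable? w) (Composite? w) λ ((_ , a) , d) → a , d)
      (𝟙-mono (Composite? w) (Apery⁺? w ×-dec Decomposable? w)
        λ (a , d@(_ , x<w , _)) → (≤-<-trans z≤n x<w , a) , d)))

    0<total : 0 < m + c
    0<total = ≤-trans 0<m (m≤m+n m c)

    -- Count `S` below `m + c` twice: as `S` below `c` plus the `m` numbers from `c` on, and as the
    -- Apéry set plus the translate by `m` of `S` below `c`. The summand 1 is the element 0.
    apery-count : m ≡ 1 + #generators + #composites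
    apery-count = begin
      m                                             ≡⟨ +-cancelˡ-≡ (sumBelow c s) m (total a) count ⟩
      total a                                       ≡⟨ sumBelow-cong (m + c) (λ w _ → split w) ⟩
      total (λ w → 𝟙 (w ≟ 0) * 1 + (𝟙 (Generator? w) + 𝟙 (Composite? w)))
        ≡⟨ sumBelow-+ (m + c) _ _ ⟩
      total (λ w → 𝟙 (w ≟ 0) * 1) + total (λ w → 𝟙 (Generator? w) + 𝟙 (Composite? w))
        ≡⟨ cong₂ _+_ (sumBelow-point (m + c) 0 1 0<total) (sumBelow-+ (m + c) _ _) ⟩
      1 + #generators + #composites                 ∎
      where
      open ≡-Reasoning
      s a : ℕ → ℕ
      s i = 𝟙 (i ∈S?)
      a w = 𝟙 (Apery? w)
      split : ∀ w → a w ≡ 𝟙 (w ≟ 0) * 1 + (𝟙 (Generator? w) + 𝟙 (Composite? w))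
      split w = trans (nonzero-split w) (cong₂ _+_ (sym (*-identityʳ (𝟙 (w ≟ 0)))) (composite-split w))
      count : sumBelow c s + m ≡ sumBelow c s + total a
      count = begin
        sumBelow c s + m
          ≡⟨ cong (sumBelow c s +_) (trans (sumBelow-const m 1) (*-identityʳ m)) ⟨
        sumBelow c s + sumBelow m (λ _ → 1)
          ≡⟨ cong (sumBelow c s +_) (sumBelow-cong m (λ i _ → 𝟙-true ((c + i) ∈S?) (above (c + i) (m≤m+n c i)))) ⟨
        sumBelow c s + sumBelow m (λ i → s (c + i))
          ≡⟨ sumBelow-append c m s ⟨
        sumBelow (c + m) s
          ≡⟨ cong (λ k → sumBelow k s) (+-comm c m) ⟩
        total s
          ≡⟨ sumBelow-cong (m + c) (λ i _ → membership-split i) ⟩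
        total (λ i → a i + shift m s i)
          ≡⟨ sumBelow-+ (m + c) a (shift m s) ⟩
        total a + total (shift m s)
          ≡⟨ cong (total a +_) (sumBelow-shift m c s) ⟩
        total a + sumBelow c s
          ≡⟨ +-comm (total a) _ ⟩
        sumBelow c s + total a ∎

    -- Summation by parts, from depth w = 1 + depth (m + w) for w < c.
    sporadic-count : sporadicCount S c ≡ q + depthSum
    sporadic-count = begin
      sporadicCount S c
        ≡⟨ countBelow≡sumBelow c ⟩
      sumBelow c s
        ≡⟨ +-cancelˡ-≡ (sumBelow c s⁺) (sumBelow c s) (total (λ w → a w * depth w)) parts ⟩
      total (λ w → a w * depth w)
        ≡⟨ sumBelow-cong (m + c) (λ w _ → split w) ⟩
      total (λ w → 𝟙 (w ≟ 0) * q + 𝟙 (Apery⁺? w) * depth w)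
        ≡⟨ sumBelow-+ (m + c) _ _ ⟩
      total (λ w → 𝟙 (w ≟ 0) * q) + depthSum
        ≡⟨ cong (_+ depthSum) (sumBelow-point (m + c) 0 q 0<total) ⟩
      q + depthSum ∎
      where
      open ≡-Reasoning
      s s⁺ a : ℕ → ℕ
      s i = 𝟙 (i ∈S?)
      s⁺ i = s i * depth (m + i)
      a w = 𝟙 (Apery? w)
      split : ∀ w → a w * depth w ≡ 𝟙 (w ≟ 0) * q + 𝟙 (Apery⁺? w) * depth w
      split w = trans (cong (_* depth w) (nonzero-split w))
        (trans (*-distribʳ-+ (depth w) (𝟙 (w ≟ 0)) _) (cong (_+ 𝟙 (Apery⁺? w) * depth w) (at-zero w)))
        where
        at-zero : ∀ w → 𝟙 (w ≟ 0) * depth w ≡ 𝟙 (w ≟ 0) * q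
        at-zero zero    = cong (_+ 0) depth-zero
        at-zero (suc w) = refl
      shifted : ∀ i → shift m s i * depth i ≡ shift m s⁺ i
      shifted i with m ≤? i
      ... | no _    = refl
      ... | yes m≤i rewrite m+[n∸m]≡n m≤i = trans (cong (_* depth i) (+-identityʳ (s (i ∸ m)))) (sym (+-identityʳ _))
      parts : sumBelow c s⁺ + sumBelow c s ≡ sumBelow c s⁺ + total (λ w → a w * depth w)
      parts = begin
        sumBelow c s⁺ + sumBelow c s
          ≡⟨ sumBelow-+ c s⁺ s ⟨
        sumBelow c (λ i → s⁺ i + s i)
          ≡⟨ sumBelow-cong c (λ i i<c → trans (+-comm (s⁺ i) (s i))
               (trans (sym (*-suc (s i) _)) (cong (s i *_) (sym (depth-step i<c))))) ⟩
        sumBelow c (λ i → s i * depth i)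
          ≡⟨ +-identityʳ _ ⟨
        -- The depth vanishes from `c` on, so the range can be extended to `m + c`.
        sumBelow c (λ i → s i * depth i) + 0
          ≡⟨ cong (sumBelow c (λ i → s i * depth i) +_)
               (sumBelow-zero m (λ i _ → trans (cong (s (c + i) *_) (depth-≥ (m≤m+n c i))) (*-zeroʳ (s (c + i))))) ⟨
        sumBelow c (λ i → s i * depth i) + sumBelow m (λ i → s (c + i) * depth (c + i))
          ≡⟨ sumBelow-append c m _ ⟨
        sumBelow (c + m) (λ i → s i * depth i)
          ≡⟨ cong (λ k → sumBelow k (λ i → s i * depth i)) (+-comm c m) ⟩
        total (λ i → s i * depth i)
          ≡⟨ sumBelow-cong (m + c) (λ i _ → trans (cong (_* depth i) (membership-split i))
               (trans (*-distribʳ-+ (depth i) (a i) _) (cong (a i * depth i +_) (shifted i)))) ⟩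
        total (λ i → a i * depth i + shift m s⁺ i)
          ≡⟨ sumBelow-+ (m + c) _ _ ⟩
        total (λ i → a i * depth i) + total (shift m s⁺)
          ≡⟨ cong (total (λ i → a i * depth i) +_) (sumBelow-shift m c s⁺) ⟩
        total (λ i → a i * depth i) + sumBelow c s⁺
          ≡⟨ +-comm _ (sumBelow c s⁺) ⟩
        sumBelow c s⁺ + total (λ i → a i * depth i) ∎

    -- Every generating list contains m and the indecomposable Apéry elements.
    generators-≤ : 0 < c → ∀ gs → Generates gs S → 1 + #generators ≤ length gs
    generators-≤ 0<c gs gen = begin
      1 + #generators
        ≡⟨ cong (_+ #generators) (sumBelow-point (m + c) m 1 (m<m+n m 0<c)) ⟨
      total (λ w → 𝟙 (w ≟ m) * 1) + #generators
        ≡⟨ sumBelow-+ (m + c) _ _ ⟨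
      total (λ w → 𝟙 (w ≟ m) * 1 + 𝟙 (Generator? w))
        ≤⟨ sumBelow-mono (m + c) (λ w _ → pointwise w) ⟩
      total (λ w → 𝟙 (w ∈? gs))
        ≤⟨ sumBelow-∈ (m + c) gs ⟩
      length gs ∎
      where
      open ≤-Reasoning
      gs⊆S : ∀ {g} → g ∈ gs → g ∈S S
      gs⊆S {g} g∈ = Equivalence.from (gen g) (combination-∈ g∈)
      m-irreducible : Irreducible m
      m-irreducible x y 0<x 0<y x∈S _ x+y≡m =
        proj₂ (proj₂ isMult) x 0<x (subst (x <_) x+y≡m (m<m+n x 0<y)) x∈S
      generator-irreducible : ∀ {w} → Generator w → Irreducible w
      generator-irreducible ((_ , a) , ¬d) x y 0<x 0<y x∈S y∈S refl =
        ¬d (decomposable-+ (0<x , apery-+ˡ x∈S y∈S a) (0<y , apery-+ʳ x∈S y∈S a))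
      pointwise : ∀ w → 𝟙 (w ≟ m) * 1 + 𝟙 (Generator? w) ≤ 𝟙 (w ∈? gs)
      pointwise w with w ≟ m
      -- Nonzero Apéry elements exceed `m`, so `m` is not counted twice.
      ... | yes refl = begin
        1 + 𝟙 (Generator? m)  ≡⟨ cong suc (𝟙-false (Generator? m) (λ (a , _) → <-irrefl refl (apery⁺->m a))) ⟩
        1                     ≡⟨ 𝟙-true (m ∈? gs) (irreducible-∈ gs⊆S 0<m m-irreducible (Equivalence.to (gen m) m∈S)) ⟨
        𝟙 (m ∈? gs)           ∎
      ... | no _ = 𝟙-mono (Generator? w) (w ∈? gs) λ g@((0<w , w∈S , _) , _) →
        irreducible-∈ gs⊆S 0<w (generator-irreducible g) (Equivalence.to (gen w) w∈S)

    -- No decomposable element below the conductor.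

    -- Wilf's inequality with `1 + #generators` for `ν`, `m = 1 + #generators + #composites` and
    -- `n = q + depthSum`, after cancelling `q * (1 + #generators)`.
    DepthBound : Set
    DepthBound = q * #composites ≤ (1 + #generators) * depthSum + ρ

    -- Double counting: every small z occurs in at most 1 + #generators of the sums w = x + y,
    -- where w = z + z is counted twice.
    no-small-composite : (∀ w → w < c → ¬ Composite w) → DepthBound
    no-small-composite none = begin
      q * #composites
        ≡⟨ sumBelow-*ˡ (m + c) q _ ⟨
      total (λ w → q * 𝟙 (Composite? w))
        ≤⟨ sumBelow-mono (m + c) (λ w _ → pointwise w) ⟩
      total (λ w → total (λ z → δ z * occ w z) + 𝟙 (last? w))
        ≡⟨ sumBelow-+ (m + c) _ _ ⟩
      total (λ w → total (λ z → δ z * occ w z)) + total (λ w → 𝟙 (last? w))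
        ≤⟨ +-monoʳ-≤ _ (≤-trans (sumBelow-last (m + c) (m + c) ρ) (≤-reflexive (m+n∸m≡n (m + c) ρ))) ⟩
      total (λ w → total (λ z → δ z * occ w z)) + ρ
        ≡⟨ cong (_+ ρ) (sumBelow-swap (m + c) (m + c) _) ⟩
      total (λ z → total (λ w → δ z * occ w z)) + ρ
        ≡⟨ cong (_+ ρ) (sumBelow-cong (m + c) (λ z _ → sumBelow-*ˡ (m + c) (δ z) (λ w → occ w z))) ⟩
      total (λ z → δ z * total (λ w → occ w z)) + ρ
        ≤⟨ +-monoˡ-≤ ρ (sumBelow-mono (m + c) (λ z _ → *-monoʳ-≤ (δ z) (occurrences z))) ⟩
      total (λ z → δ z * (1 + #generators)) + ρ
        ≡⟨ cong (_+ ρ) (sumBelow-*ʳ (m + c) (1 + #generators) δ) ⟩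
      depthSum * (1 + #generators) + ρ
        ≡⟨ cong (_+ ρ) (*-comm depthSum (1 + #generators)) ⟩
      (1 + #generators) * depthSum + ρ ∎
      where
      open ≤-Reasoning
      Small? : ∀ w → Dec (Apery⁺ w × w < c)
      Small? w = Apery⁺? w ×-dec w <? c
      small : ℕ → ℕ
      small w = 𝟙 (Small? w)
      δ : ℕ → ℕ
      δ z = 𝟙 (Apery⁺? z) * depth z
      -- The `shift` term records `w = z + y` with `y` small; the other term adds one more when
      -- `w = z + z`.
      occ : ℕ → ℕ → ℕ
      occ w z = 𝟙 (w ≟ z + z) + shift z small w
      occurrences : ∀ z → total (λ w → occ w z) ≤ 1 + #generators
      occurrences z = begin
        total (λ w → occ w z)
          ≡⟨ sumBelow-+ (m + c) _ _ ⟩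
        total (λ w → 𝟙 (w ≟ z + z)) + total (shift z small)
          ≤⟨ +-mono-≤ (sumBelow-point-≤ (m + c) (z + z)) (sumBelow-shift-≤ z (m + c) small) ⟩
        1 + total small
          -- Without composites below `c`, every small element is a generator.
          ≤⟨ +-monoʳ-≤ 1 (sumBelow-mono (m + c) (λ w _ → 𝟙-mono (Small? w) (Generator? w)
               λ (a , w<c) → a , λ d → none w w<c (proj₂ a , d))) ⟩
        1 + #generators ∎
      δ-apery : ∀ {z} → Apery⁺ z → δ z ≡ depth z
      δ-apery {z} az = trans (cong (_* depth z) (𝟙-true (Apery⁺? z) az)) (+-identityʳ (depth z))
      occ-≥ : ∀ {x y} → Apery⁺ y → y < c → 1 ≤ occ (x + y) x
      occ-≥ {x} {y} ay y<c = begin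
        1                          ≡⟨ 𝟙-true (Small? y) (ay , y<c) ⟨
        small y                    ≡⟨ shift-+ x small y ⟨
        shift x small (x + y)      ≤⟨ m≤n+m _ _ ⟩
        occ (x + y) x              ∎
      term-≥ : ∀ {x y} → Apery⁺ x → Apery⁺ y → y < c → depth x ≤ δ x * occ (x + y) x
      term-≥ {x} {y} ax ay y<c = begin
        depth x                ≡⟨ δ-apery ax ⟨
        δ x                    ≡⟨ *-identityʳ (δ x) ⟨
        δ x * 1                ≤⟨ *-monoʳ-≤ (δ x) (occ-≥ {x} ay y<c) ⟩
        δ x * occ (x + y) x    ∎
      decomposition : ∀ {x y} → Apery⁺ x → Apery⁺ y → Apery (x + y) →
                      depth x + depth y ≤ total (λ z → δ z * occ (x + y) z)
      decomposition {x} {y} ax ay a with x ≟ y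
      -- For `x = y` a single term of the sum has to pay for both summands, hence the multiplicity
      -- 2.
      ... | yes refl = begin
        depth x + depth x                 ≡⟨ cong₂ _+_ (δ-apery ax) (δ-apery ax) ⟨
        δ x + δ x                         ≡⟨ cong (δ x +_) (*-identityʳ (δ x)) ⟨
        δ x + δ x * 1                     ≡⟨ *-suc (δ x) 1 ⟨
        δ x * 2                           ≤⟨ *-monoʳ-≤ (δ x) twice ⟩
        δ x * occ (x + x) x               ≡⟨ +-identityʳ _ ⟨
        δ x * occ (x + x) x + 0           ≤⟨ sum-≤-sumBelow (m + c) _ (x ∷ []) ([]ᴬ ∷ᵁ []ᵁ) (apery-< (proj₂ ax) ∷ᴬ []ᴬ) ⟩
        total (λ z → δ z * occ (x + x) z) ∎
        where
        twice : 2 ≤ occ (x + x) x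
        twice = ≤-reflexive (sym (cong₂ _+_ (𝟙-true (x + x ≟ x + x) refl)
          (trans (shift-+ x small x) (𝟙-true (Small? x) (ax , summand-< ay a)))))
      ... | no x≢y = begin
        depth x + depth y
          ≤⟨ +-mono-≤ (term-≥ ax ay (summand-< ax (subst Apery (+-comm x y) a))) (term-≥ ay ax (summand-< ay a)) ⟩
        δ x * occ (x + y) x + δ y * occ (y + x) y
          ≡⟨ cong (λ w → δ x * occ (x + y) x + δ y * occ w y) (+-comm y x) ⟩
        δ x * occ (x + y) x + δ y * occ (x + y) y
          ≡⟨ cong (δ x * occ (x + y) x +_) (+-identityʳ _) ⟨
        δ x * occ (x + y) x + (δ y * occ (x + y) y + 0)
          ≤⟨ sum-≤-sumBelow (m + c) _ (x ∷ y ∷ []) ((x≢y ∷ᴬ []ᴬ) ∷ᵁ []ᴬ ∷ᵁ []ᵁ)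
               (apery-< (proj₂ ax) ∷ᴬ apery-< (proj₂ ay) ∷ᴬ []ᴬ) ⟩
        total (λ z → δ z * occ (x + y) z) ∎
      bound : ∀ {w} → Composite w → q ≤ total (λ z → δ z * occ w z) + 𝟙 (last? w)
      bound (a , d) with decompose d
      ... | x , y , refl , ax , ay = ≤-trans (depth-+ a) (+-monoˡ-≤ _ (decomposition ax ay a))
      pointwise : ∀ w → q * 𝟙 (Composite? w) ≤ total (λ z → δ z * occ w z) + 𝟙 (last? w)
      pointwise w = *𝟙-≤ q (Composite? w) bound

    -- A decomposable element below the conductor, with `depthSum` at most `q`.

    -- Used to refute configurations: a few distinct elements whose depths exceed `q` contradict
    -- `depthSum ≤ q`.
    depthSum-≥ : ∀ xs → Unique xs → All Apery⁺ xs → sum (map depth xs) ≤ depthSum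
    depthSum-≥ xs uniq ap = subst (_≤ depthSum) (weights ap)
      (sum-≤-sumBelow (m + c) (λ w → 𝟙 (Apery⁺? w) * depth w) xs uniq (All.map (apery-< ∘ proj₂) ap))
      where
      weights : ∀ {ys} → All Apery⁺ ys → sum (map (λ w → 𝟙 (Apery⁺? w) * depth w) ys) ≡ sum (map depth ys)
      weights []ᴬ = refl
      weights (_∷ᴬ_ {y} ay ays) =
        cong₂ _+_ (trans (cong (_* depth y) (𝟙-true (Apery⁺? y) ay)) (+-identityʳ (depth y))) (weights ays)

    module _ (few : depthSum ≤ q) where

      -- For `x ≢ y` the distinct elements `x`, `y`, `x + y` would have total depth at least
      -- `q + 1`.
      small-double : ∀ {x y} → Apery⁺ x → Apery⁺ y → Apery (x + y) → x + y < c → x ≡ y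
      small-double {x} {y} ax ay a w<c with x ≟ y
      ... | yes x≡y = x≡y
      ... | no x≢y = ⊥-elim (n≮0 (arith (depth x) (depth y) (depth (x + y))
          (≤-trans (depthSum-≥ (x ∷ y ∷ x + y ∷ [])
            ((x≢y ∷ᴬ <⇒≢ (m<m+n x (proj₁ ay)) ∷ᴬ []ᴬ) ∷ᵁ (<⇒≢ (m<n+m y (proj₁ ax)) ∷ᴬ []ᴬ) ∷ᵁ []ᴬ ∷ᵁ []ᵁ)
            (ax ∷ᴬ ay ∷ᴬ (≤-trans (proj₁ ax) (m≤m+n x y) , a) ∷ᴬ []ᴬ)) few)
          (depth-+-small a w<c) (depth-pos w<c)))
        where
        arith : ∀ u v t → u + (v + (t + 0)) ≤ q → q ≤ u + v → 1 ≤ t → 1 ≤ 0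
        arith u v t h₁ h₂ h₃ = linear {p = 1} {q = 0} 0 (+-mono-≤ h₁ (+-mono-≤ h₂ h₃))
          (solve (u ∷ v ∷ t ∷ q ∷ []))

      module _ {x : ℕ} (ax : Apery⁺ x) (a₂ : Apery (x + x)) (x₂<c : x + x < c) where

        x₂ : ℕ
        x₂ = x + x

        x≢x₂ : x ≢ x₂
        x≢x₂ = <⇒≢ (m<m+n x (proj₁ ax))

        ax₂ : Apery⁺ x₂
        ax₂ = ≤-trans (proj₁ ax) (m≤m+n x x) , a₂

        q≤2depth : q ≤ depth x + depth x
        q≤2depth = depth-+-small a₂ x₂<c

        depth-+-1 : ∀ {y z} → Apery (y + z) → q ≤ depth y + depth z + 1
        depth-+-1 {y} {z} a = ≤-trans (depth-+ a) (+-monoʳ-≤ (depth y + depth z) (𝟙≤1 (last? (y + z))))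

        -- Three distinct elements `x`, `y`, `z` would have twice their total depth at least
        -- `q + (q − 1) + 2`: here `2 depth x ≥ q`, and `depth y + depth z` is at least both `q − 1`
        -- and 2.
        summand-is-x : ∀ {y z} → Apery⁺ y → Apery⁺ z → Apery (y + z) → y ≡ x ⊎ z ≡ x
        summand-is-x {y} {z} ay az a with y ≟ x | z ≟ x | y ≟ z
        ... | yes y≡x | _       | _       = inj₁ y≡x
        ... | no _    | yes z≡x | _       = inj₂ z≡x
        ... | no y≢x  | no z≢x  | no y≢z  = ⊥-elim (n≮0 (arith (depth x) (depth y) (depth z)
            (≤-trans (depthSum-≥ (x ∷ y ∷ z ∷ [])
              (((y≢x ∘ sym) ∷ᴬ (z≢x ∘ sym) ∷ᴬ []ᴬ) ∷ᵁ (y≢z ∷ᴬ []ᴬ) ∷ᵁ []ᴬ ∷ᵁ []ᵁ)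
              (ax ∷ᴬ ay ∷ᴬ az ∷ᴬ []ᴬ)) few)
            q≤2depth (depth-+-1 a)
            (depth-pos (summand-< az a)) (depth-pos (summand-< ay (subst Apery (+-comm y z) a)))))
          where
          arith : ∀ u v t → u + (v + (t + 0)) ≤ q → q ≤ u + u → q ≤ v + t + 1 → 1 ≤ v → 1 ≤ t → 1 ≤ 0
          arith u v t h₁ h₂ h₃ h₄ h₅ = linear {p = 1} {q = 0} 0
            (+-mono-≤ (+-mono-≤ (+-mono-≤ h₁ h₁) (+-mono-≤ h₂ h₃)) (+-mono-≤ h₄ h₅))
            (solve (u ∷ v ∷ t ∷ q ∷ []))
        ... | no y≢x  | no _    | yes refl with y ≟ x₂
        -- For `y = z` the third element is `x₂`: twice the total depth is at least
        -- `q + 2 + (q − 1)`.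
        ...   | no y≢x₂ = ⊥-elim (n≮0 (arith (depth x) (depth x₂) (depth y)
            (≤-trans (depthSum-≥ (x ∷ x₂ ∷ y ∷ [])
              ((x≢x₂ ∷ᴬ (y≢x ∘ sym) ∷ᴬ []ᴬ) ∷ᵁ ((y≢x₂ ∘ sym) ∷ᴬ []ᴬ) ∷ᵁ []ᴬ ∷ᵁ []ᵁ)
              (ax ∷ᴬ ax₂ ∷ᴬ ay ∷ᴬ []ᴬ)) few)
            q≤2depth (depth-+-1 a) (depth-pos x₂<c)))
          where
          arith : ∀ u v t → u + (v + (t + 0)) ≤ q → q ≤ u + u → q ≤ t + t + 1 → 1 ≤ v → 1 ≤ 0
          arith u v t h₁ h₂ h₃ h₄ = linear {p = 1} {q = 0} 0
            (+-mono-≤ (+-mono-≤ (+-mono-≤ h₁ h₁) (+-mono-≤ h₂ h₃)) (+-mono-≤ h₄ h₄))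
            (solve (u ∷ v ∷ t ∷ q ∷ []))
        -- Now `y + z = 4x`, so `3x` is an Apéry element below `c`, and `small-double` would force
        -- `x₂ = x`.
        ...   | yes refl = contradiction (sym (small-double ax₂ ax a₃ (summand-< ax a′))) x≢x₂
          where
          a′ : Apery (x₂ + x + x)
          a′ = subst Apery (sym (+-assoc x₂ x x)) a
          a₃ : Apery (x₂ + x)
          a₃ = apery-+ˡ (mem-add S x₂ x (proj₁ a₂) (proj₁ (proj₂ ax))) (proj₁ (proj₂ ax)) a′

        -- The two summands agree by `small-double`, and one of them is `x`.
        small-composite : ∀ {w} → w < c → Composite w → w ≡ x₂
        small-composite w<c (a , d) with decompose d
        ... | y , z , refl , ay , az with small-double ay az a w<c | summand-is-x ay az a
        ...   | refl | inj₁ refl = refl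
        ...   | refl | inj₂ refl = refl

        small-generator : ∀ {z} → Apery⁺ z → z < c → z ≢ x₂ → Generator z
        small-generator az z<c z≢x₂ = az , λ d → z≢x₂ (small-composite z<c (proj₂ az , d))

        gx : Generator x
        gx = small-generator ax (summand-< ax a₂) x≢x₂

        composite-shape : ∀ {w} → Composite w → ∃ λ z → w ≡ x + z × Apery⁺ z × z < c
        composite-shape (a , d) with decompose d
        ... | y , z , refl , ay , az with summand-is-x ay az a
        ...   | inj₁ refl = z , refl , az , summand-< ax (subst Apery (+-comm y z) a)
        ...   | inj₂ refl = y , +-comm y z , ay , summand-< ax a

        -- A further summand besides `x` and `x₂`.

        -- Such a `y` makes `x + y` a decomposable element other than `x + x` and `x + x₂`.
        Third : ℕ → Set
        Third y = Apery⁺ y × y ≢ x × y ≢ x₂ × Apery (x + y)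

        Third? : ∀ y → Dec (Third y)
        Third? y = Apery⁺? y ×-dec (¬? (y ≟ x) ×-dec (¬? (y ≟ x₂) ×-dec Apery? (x + y)))

        -- `depth x + depth y ≥ q − 1` and `depth x₂ ≥ 1` already exhaust `q`, so there is no fourth
        -- summand and `depthSum ≥ q`. At most three composites face the factor
        -- `1 + #generators ≥ 3`, from `m`, `x` and `y`.
        with-third : ∀ {y} → y < c → Third y → DepthBound
        with-third {y} y<c (ay , y≢x , y≢x₂ , a) = arith (depth x) (depth x₂) (depth y)
          (depthSum-≥ (x ∷ x₂ ∷ y ∷ [])
              ((x≢x₂ ∷ᴬ (y≢x ∘ sym) ∷ᴬ []ᴬ) ∷ᵁ ((y≢x₂ ∘ sym) ∷ᴬ []ᴬ) ∷ᵁ []ᴬ ∷ᵁ []ᵁ)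
              (ax ∷ᴬ ax₂ ∷ᴬ ay ∷ᴬ []ᴬ))
          (depth-+-1 a) (depth-pos x₂<c)
          (count-≤ (m + c) Composite? (x + x ∷ x + x₂ ∷ x + y ∷ []) composite-list)
          (count-≥ (m + c) Generator? (x ∷ y ∷ []) (((y≢x ∘ sym) ∷ᴬ []ᴬ) ∷ᵁ []ᴬ ∷ᵁ []ᵁ)
            (apery-< (proj₂ ax) ∷ᴬ apery-< (proj₂ ay) ∷ᴬ []ᴬ)
            (gx ∷ᴬ small-generator ay y<c y≢x₂ ∷ᴬ []ᴬ))
          where
          -- `x + x₂` is listed whether or not it is an Apéry element; the list serves as an upper
          -- bound.
          composite-list : ∀ {w} → Composite w → w ∈ x + x ∷ x + x₂ ∷ x + y ∷ []
          composite-list (aw , d) with composite-shape (aw , d)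
          ... | z , refl , az , z<c with z ≟ x | z ≟ x₂ | z ≟ y
          ...   | yes refl | _        | _        = here refl
          ...   | no _     | yes refl | _        = there (here refl)
          ...   | no _     | no _     | yes refl = there (there (here refl))
          ...   | no z≢x   | no z≢x₂  | no z≢y   = ⊥-elim (n≮0 (four (depth x) (depth x₂) (depth y) (depth z)
              (≤-trans (depthSum-≥ (x ∷ x₂ ∷ y ∷ z ∷ [])
                ((x≢x₂ ∷ᴬ (y≢x ∘ sym) ∷ᴬ (z≢x ∘ sym) ∷ᴬ []ᴬ) ∷ᵁ ((y≢x₂ ∘ sym) ∷ᴬ (z≢x₂ ∘ sym) ∷ᴬ []ᴬ)
                  ∷ᵁ ((z≢y ∘ sym) ∷ᴬ []ᴬ) ∷ᵁ []ᴬ ∷ᵁ []ᵁ)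
                (ax ∷ᴬ ax₂ ∷ᴬ ay ∷ᴬ az ∷ᴬ []ᴬ)) few)
              (depth-+-1 a) (depth-pos x₂<c) (depth-pos z<c)))
            where
            four : ∀ u v t s → u + (v + (t + (s + 0))) ≤ q → q ≤ u + t + 1 → 1 ≤ v → 1 ≤ s → 1 ≤ 0
            four u v t s h₁ h₂ h₃ h₄ = linear {p = 1} {q = 0} 0
              (+-mono-≤ (+-mono-≤ h₁ h₂) (+-mono-≤ h₃ h₄)) (solve (u ∷ v ∷ t ∷ s ∷ q ∷ []))
          arith : ∀ u v t → u + (v + (t + 0)) ≤ depthSum → q ≤ u + t + 1 → 1 ≤ v →
                  #composites ≤ 3 → 2 ≤ #generators → DepthBound
          arith u v t h₁ h₂ h₃ h₄ h₅ = begin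
            q * #composites                  ≤⟨ *-mono-≤ q≤D h₄ ⟩
            depthSum * 3                     ≡⟨ *-comm depthSum 3 ⟩
            3 * depthSum                     ≤⟨ *-monoˡ-≤ depthSum (s≤s h₅) ⟩
            (1 + #generators) * depthSum     ≤⟨ m≤m+n _ ρ ⟩
            (1 + #generators) * depthSum + ρ ∎
            where
            open ≤-Reasoning
            q≤D : q ≤ depthSum
            q≤D = begin
              q                  ≤⟨ h₂ ⟩
              u + t + 1          ≤⟨ +-monoʳ-≤ (u + t) h₃ ⟩
              u + t + v          ≡⟨ solve (u ∷ v ∷ t ∷ []) ⟩
              u + (v + (t + 0))  ≤⟨ h₁ ⟩
              depthSum           ∎

        -- At most two decomposable elements, `x₂` and `x₃`.

        module _ (no-third : ∀ y → y < c → ¬ Third y) (gap : ∀ {f} → c ≡ suc f → ¬ f ∈S S) where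

          x₃ : ℕ
          x₃ = x + x₂

          composite-≡ : ∀ {w} → Composite w → w ≡ x₂ ⊎ w ≡ x₃
          composite-≡ (aw , d) with composite-shape (aw , d)
          ... | z , refl , az , z<c with z ≟ x | z ≟ x₂
          ...   | yes refl | _        = inj₁ refl
          ...   | no _     | yes refl = inj₂ refl
          ...   | no z≢x   | no z≢x₂  = contradiction (az , z≢x , z≢x₂ , aw) (no-third z z<c)

          1≤#generators : 1 ≤ #generators
          1≤#generators = count-≥ (m + c) Generator? (x ∷ []) ([]ᴬ ∷ᵁ []ᵁ) (apery-< (proj₂ ax) ∷ᴬ []ᴬ) (gx ∷ᴬ []ᴬ)

          -- A single composite costs only `q ≤ 2 depth x`, and `m` and `x` give the factor 2.
          one-composite : ¬ Apery x₃ → DepthBound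
          one-composite ¬a₃ = begin
            q * #composites                   ≤⟨ *-monoʳ-≤ q (count-≤ (m + c) Composite? (x₂ ∷ []) only) ⟩
            q * 1                             ≡⟨ *-identityʳ q ⟩
            q                                 ≤⟨ q≤2depth ⟩
            depth x + depth x                 ≤⟨ +-mono-≤ depth≤ depth≤ ⟩
            depthSum + depthSum               ≡⟨ cong (depthSum +_) (+-identityʳ depthSum) ⟨
            2 * depthSum                      ≤⟨ *-monoˡ-≤ depthSum (s≤s 1≤#generators) ⟩
            (1 + #generators) * depthSum      ≤⟨ m≤m+n _ ρ ⟩
            (1 + #generators) * depthSum + ρ  ∎
            where
            open ≤-Reasoning
            depth≤ : depth x ≤ depthSum
            depth≤ = subst (_≤ depthSum) (+-identityʳ (depth x)) (depthSum-≥ (x ∷ []) ([]ᴬ ∷ᵁ []ᵁ) (ax ∷ᴬ []ᴬ))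
            only : ∀ {w} → Composite w → w ∈ x₂ ∷ []
            only (aw , d) with composite-≡ (aw , d)
            ... | inj₁ w≡x₂ = here w≡x₂
            ... | inj₂ refl = contradiction aw ¬a₃

          #composites≤2 : #composites ≤ 2
          #composites≤2 = count-≤ (m + c) Composite? (x₂ ∷ x₃ ∷ []) λ cw → case composite-≡ cw of λ where
            (inj₁ w≡x₂) → here w≡x₂
            (inj₂ w≡x₃) → there (here w≡x₃)

          module _ (a₃ : Apery x₃) where

            #composites≡2 : #composites ≡ 2
            #composites≡2 = ≤-antisym #composites≤2 (count-≥ (m + c) Composite? (x₂ ∷ x₃ ∷ [])
              ((<⇒≢ (m<n+m x₂ (proj₁ ax)) ∷ᴬ []ᴬ) ∷ᵁ []ᴬ ∷ᵁ []ᵁ)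
              (apery-< a₂ ∷ᴬ apery-< a₃ ∷ᴬ []ᴬ)
              ((a₂ , decomposable-+ ax ax) ∷ᴬ (a₃ , decomposable-+ ax ax₂) ∷ᴬ []ᴬ))

            2depths≤ : depth x + depth x₂ ≤ depthSum
            2depths≤ = subst (λ t → depth x + t ≤ depthSum) (+-identityʳ (depth x₂))
              (depthSum-≥ (x ∷ x₂ ∷ []) ((x≢x₂ ∷ᴬ []ᴬ) ∷ᵁ []ᴬ ∷ᵁ []ᵁ) (ax ∷ᴬ ax₂ ∷ᴬ []ᴬ))

            0<depth : 1 ≤ depth x
            0<depth = depth-pos (summand-< ax a₂)

            -- `depthSum` is at least both `q − 1` and 2, so `3 * depthSum ≥ 2 (q − 1) + 2`; the
            -- third generator is `m`.
            three-generators : 2 ≤ #generators → DepthBound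
            three-generators 2≤G = begin
              q * #composites                   ≤⟨ *-monoʳ-≤ q #composites≤2 ⟩
              q * 2                             ≤⟨ arith (depth x) (depth x₂) depthSum (depth-+-1 a₃) 0<depth (depth-pos x₂<c) 2depths≤ ⟩
              3 * depthSum                      ≤⟨ *-monoˡ-≤ depthSum (s≤s 2≤G) ⟩
              (1 + #generators) * depthSum      ≤⟨ m≤m+n _ ρ ⟩
              (1 + #generators) * depthSum + ρ  ∎
              where
              open ≤-Reasoning
              arith : ∀ u v D → q ≤ u + v + 1 → 1 ≤ u → 1 ≤ v → u + v ≤ D → q * 2 ≤ 3 * D
              arith u v D h₁ h₂ h₃ h₄ = linear {p = q * 2} {q = 3 * D} 0
                (+-mono-≤ (+-mono-≤ (+-mono-≤ h₁ h₁) (+-mono-≤ h₂ h₃)) (+-mono-≤ h₄ (+-mono-≤ h₄ h₄)))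
                (solve (u ∷ v ∷ D ∷ q ∷ []))

            -- Only `m` and `x` are counted. As `depthSum ≥ q − 1`, the premise holds for `ρ ≥ 2`;
            -- for `ρ = 0` no sum is exceptional and `depthSum ≥ q`; this leaves `ρ = 1`.
            two-generators : q * 2 ≤ 2 * depthSum + ρ → DepthBound
            two-generators h = begin
              q * #composites                   ≤⟨ *-monoʳ-≤ q #composites≤2 ⟩
              q * 2                             ≤⟨ h ⟩
              2 * depthSum + ρ                  ≤⟨ +-monoˡ-≤ ρ (*-monoˡ-≤ depthSum (s≤s 1≤#generators)) ⟩
              (1 + #generators) * depthSum + ρ  ∎
              where open ≤-Reasoning

            two-generators-ρ≡0 : ρ ≡ 0 → q * 2 ≤ 2 * depthSum + ρ
            two-generators-ρ≡0 ρ≡0 = arith (depth x) (depth x₂) depthSum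
              (subst (λ t → q ≤ depth x + depth x₂ + t) (𝟙-false (last? x₃) not-last) (depth-+ a₃)) 2depths≤
              where
              not-last : ¬ (m + c ≤ x₃ + ρ)
              not-last = <⇒≱ (subst (_< m + c) (sym (trans (cong (x₃ +_) ρ≡0) (+-identityʳ x₃))) (apery-< a₃))
              arith : ∀ u v D → q ≤ u + v + 0 → u + v ≤ D → q * 2 ≤ 2 * D + ρ
              arith u v D h₁ h₂ = linear {p = q * 2} {q = 2 * D + ρ} ρ (+-mono-≤ (+-mono-≤ h₁ h₁) (+-mono-≤ h₂ h₂))
                (solve (u ∷ v ∷ D ∷ q ∷ ρ ∷ []))

            two-generators-ρ≥2 : 2 ≤ ρ → q * 2 ≤ 2 * depthSum + ρ
            two-generators-ρ≥2 = arith (depth x) (depth x₂) depthSum (depth-+-1 a₃) 2depths≤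
              where
              arith : ∀ u v D → q ≤ u + v + 1 → u + v ≤ D → 2 ≤ ρ → q * 2 ≤ 2 * D + ρ
              arith u v D h₁ h₂ h₃ = linear {p = q * 2} {q = 2 * D + ρ} 0
                (+-mono-≤ (+-mono-≤ (+-mono-≤ h₁ h₁) (+-mono-≤ h₂ h₂)) h₃)
                (solve (u ∷ v ∷ D ∷ q ∷ ρ ∷ []))

            -- Here the Apéry set of m = 4 is {0, x, 2x, 3x} with 3x = c + 3 = 4q + 2,
            -- so x is even and 2x is a multiple of m.
            ρ≢1 : #generators ≡ 1 → ρ ≢ 1
            ρ≢1 G≡1 ρ≡1 = at c refl
              where
              m≡4 : m ≡ 4
              m≡4 = trans apery-count (cong₂ (λ g p → 1 + g + p) G≡1 #composites≡2)
              -- From `3x = 4q + 2 = 2 (x + h)` follows `x = 2h`, hence `2x = 4h`.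
              even : ∀ h → x + h ≡ 2 * q + 1 → x + x₂ ≡ 4 * q + 2 → x₂ ≡ h * 4
              even h h₁ h₂ = +-cancelʳ-≡ (4 * x) x₂ (h * 4) (begin
                x + x + 4 * x                  ≡⟨ solve (x ∷ []) ⟩
                (x + (x + x)) + (x + (x + x))  ≡⟨ cong₂ _+_ h₂ h₂ ⟩
                (4 * q + 2) + (4 * q + 2)      ≡⟨ solve (q ∷ []) ⟩
                4 * (2 * q + 1)                ≡⟨ cong (4 *_) h₁ ⟨
                4 * (x + h)                    ≡⟨ solve (x ∷ h ∷ []) ⟩
                h * 4 + 4 * x                  ∎)
                where open ≡-Reasoning
              not-multiple : ∀ h → x₂ ≢ h * m
              not-multiple zero    x₂≡0 = <⇒≢ (proj₁ ax₂) (sym x₂≡0)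
              not-multiple (suc h) eq = proj₂ a₂
                ( subst (m ≤_) (sym eq) (m≤m+n m (h * m))
                , subst (_∈S S) (sym (trans (cong (_∸ m) eq) (m+n∸m≡n m (h * m)))) (multiple-∈S h m∈S))
              -- Matching on a copy `c′` yields the predecessor while `c` stays a variable.
              at : ∀ c′ → c′ ≢ c
              at zero    0≡c = n≮0 (subst (x + x <_) (sym 0≡c) x₂<c)
              at (suc f) c≡1+f = not-multiple h (trans (even h (m+[n∸m]≡n x≤) 3x≡) (cong (h *_) (sym m≡4)))
                where
                c≤m+f : c ≤ m + f
                c≤m+f = subst (_≤ m + f) c≡1+f (+-monoˡ-≤ f 0<m)
                -- Subtracting `m` leaves the gap `f = c − 1`.
                a-last : Apery⁺ (m + f)
                a-last = ≤-trans 0<m (m≤m+n m f) , above (m + f) c≤m+f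
                  , λ (_ , p) → gap (sym c≡1+f) (subst (_∈S S) (m+n∸m≡n m f) p)
                -- If indecomposable, `m + f` would be a second generator besides `x`; being at
                -- least `c`, it is not `x₂`.
                m+f≡x₃ : Dec (Decomposable (m + f)) → m + f ≡ x₃
                m+f≡x₃ (yes d) with composite-≡ (proj₂ a-last , d)
                ... | inj₁ eq = contradiction eq (>⇒≢ (<-≤-trans x₂<c c≤m+f))
                ... | inj₂ eq = eq
                m+f≡x₃ (no ¬d) = contradiction
                  (count-≥ (m + c) Generator? (x ∷ m + f ∷ [])
                    ((<⇒≢ (<-≤-trans (summand-< ax a₂) c≤m+f) ∷ᴬ []ᴬ) ∷ᵁ []ᴬ ∷ᵁ []ᵁ)
                    (apery-< (proj₂ ax) ∷ᴬ apery-< (proj₂ a-last) ∷ᴬ []ᴬ) (gx ∷ᴬ (a-last , ¬d) ∷ᴬ []ᴬ))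
                  (<⇒≱ (s≤s (≤-reflexive G≡1)))
                3x≡ : x + x₂ ≡ 4 * q + 2
                3x≡ = begin
                  x + x₂        ≡⟨ m+f≡x₃ (Decomposable? (m + f)) ⟨
                  m + f         ≡⟨ cong (_+ f) m≡4 ⟩
                  4 + f         ≡⟨ solve (f ∷ []) ⟩
                  suc f + 1 + 2 ≡⟨ cong₂ (λ s t → s + t + 2) c≡1+f (sym ρ≡1) ⟩
                  c + ρ + 2     ≡⟨ cong (_+ 2) c+ρ≡qm ⟩
                  q * m + 2     ≡⟨ cong (λ t → q * t + 2) m≡4 ⟩
                  q * 4 + 2     ≡⟨ cong (_+ 2) (*-comm q 4) ⟩
                  4 * q + 2     ∎
                  where open ≡-Reasoning
                x≤ : x ≤ 2 * q + 1
                x≤ = *-cancelˡ-≤ 2 (begin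
                  2 * x            ≡⟨ cong (x +_) (+-identityʳ x) ⟩
                  x + x            ≤⟨ m≤n+m (x + x) x ⟩
                  x + x₂           ≡⟨ 3x≡ ⟩
                  4 * q + 2        ≡⟨ solve (q ∷ []) ⟩
                  2 * (2 * q + 1)  ∎)
                  where open ≤-Reasoning
                h : ℕ
                h = 2 * q + 1 ∸ x

            two-composites : DepthBound
            two-composites with 2 ≤? #generators | ρ ≟ 0 | ρ ≟ 1
            ... | yes 2≤G | _       | _       = three-generators 2≤G
            ... | no _    | yes ρ≡0 | _       = two-generators (two-generators-ρ≡0 ρ≡0)
            ... | no 2≰G  | no _    | yes ρ≡1 =
              contradiction ρ≡1 (ρ≢1 (≤-antisym (≤-pred (≰⇒> 2≰G)) 1≤#generators))
            ... | no _    | no ρ≢0  | no ρ≢1  =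
              two-generators (two-generators-ρ≥2 (≤∧≢⇒< (n≢0⇒n>0 ρ≢0) (ρ≢1 ∘ sym)))

        small-composite-bound : (∀ {f} → c ≡ suc f → ¬ f ∈S S) → DepthBound
        small-composite-bound gap with anyUpTo? Third? c
        ... | yes (y , y<c , third) = with-third y<c third
        ... | no none with Apery? (x + x₂)
        ...   | yes a₃ = two-composites (λ y y<c t → none (y , y<c , t)) gap a₃
        ...   | no ¬a₃ = one-composite (λ y y<c t → none (y , y<c , t)) gap ¬a₃

    -- Assembly of the cases.

    depth-bound : depthSum ≤ q → (∀ {f} → c ≡ suc f → ¬ f ∈S S) → DepthBound
    depth-bound few gap with anyUpTo? Composite? c
    ... | no none = no-small-composite λ w w<c cw → none (w , w<c , cw)
    ... | yes (w , w<c , a , d) with decompose d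
    ...   | x , y , refl , ax , ay with small-double few ax ay a w<c
    ...     | refl = small-composite-bound few ax a w<c gap

    wilf : IsConductor S c → ∀ gs → Generates gs S → q * m ≤ (2 * q + 1) * length gs →
           c ≤ length gs * sporadicCount S c
    wilf cond gs gen hyp = subst (λ n → c ≤ length gs * n) (sym sporadic-count) (go c refl)
      where
      open ≤-Reasoning
      -- This undoes the cancellation made in `DepthBound`.
      arith : ∀ g p D → c + ρ ≡ q * (1 + g + p) → q * p ≤ (1 + g) * D + ρ → c ≤ (1 + g) * (q + D)
      arith g p D h₁ h₂ = linear {p = c} {q = (1 + g) * (q + D)} 0 (+-mono-≤ (≤-reflexive h₁) h₂)
        (solve (g ∷ p ∷ D ∷ c ∷ ρ ∷ q ∷ []))
      go : ∀ c′ → c′ ≡ c → c ≤ length gs * (q + depthSum)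
      -- The case `c = 0` is split off because `generators-≤` requires `0 < c`.
      go zero refl = z≤n
      go (suc f) refl with depthSum ≤? q
      ... | yes few = begin
        c                                   ≤⟨ arith #generators #composites depthSum
                                                 (trans c+ρ≡qm (cong (q *_) apery-count)) (depth-bound few λ where refl → proj₂ cond) ⟩
        (1 + #generators) * (q + depthSum)  ≤⟨ *-monoˡ-≤ (q + depthSum) (generators-≤ (s≤s z≤n) gs gen) ⟩
        length gs * (q + depthSum)          ∎
      -- The hypothesis relating `m` and `ν` enters here, where `depthSum > q` gives `n ≥ 2q + 1`.
      ... | no many = begin
        c                           ≤⟨ m≤m+n c ρ ⟩
        c + ρ                       ≡⟨ c+ρ≡qm ⟩
        q * m                       ≤⟨ hyp ⟩
        (2 * q + 1) * length gs     ≡⟨ *-comm (2 * q + 1) (length gs) ⟩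
        length gs * (2 * q + 1)     ≤⟨ *-monoʳ-≤ (length gs) (more depthSum (≰⇒> many)) ⟩
        length gs * (q + depthSum)  ∎
        where
        more : ∀ D → q < D → 2 * q + 1 ≤ q + D
        more D q<D = linear {p = 2 * q + 1} {q = q + D} 0 q<D (solve (q ∷ D ∷ []))

-- To stay in the natural numbers, `(2 + 1/q) ν ≥ m` is multiplied by `q`, and `c = qm − ρ` is
-- written as a sum.
theorem3 : (S : NumericalSemigroup) (m ν c q ρ : ℕ) →
    IsMultiplicity S m → IsEmbeddingDimension S ν → IsConductor S c →
    c + ρ ≡ q * m → ρ < m →
    q * m ≤ (2 * q + 1) * ν →
    c ≤ ν * sporadicCount S c
theorem3 S m ν c q ρ isMult ((gs , gen , refl) , _) isCond c+ρ≡qm ρ<m =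
  wilf S {q = q} isMult (above c isCond) c+ρ≡qm ρ<m isCond gs gen
  where
  above : ∀ c → IsConductor S c → ∀ k → c ≤ k → k ∈S S
  above zero    all        k _ = all k
  above (suc f) (all , _) = all
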